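{- For every composition $\lambda$ of $n$, the poset $C_\lambda\subseteq S_n$, with the restriction of the Bruhat-Chevalley ordering of $S_n$, is EL-shellable.
   Context: $S_n$ is the symmetric group on $[n]=\{1,\dots,n\}$. The standard cyclic form of $\pi\in S_n$ is its expression as a product of disjoint cycles $(a_{1,1},\dots,a_{k_1,1})\cdots(a_{1,m},\dots,a_{k_m,m})$, where cycles of length one are NOT omitted, each cycle begins with its smallest entry, and cycles are ordered by increasing first entries. The composition type of $\pi$ is $(k_1,\dots,k_m)\vDash n$. The map $\Omega:S_n\to S_n$ sends $\pi$ to the permutation whose one-line notation is the word obtained by deleting the parentheses from the standard cyclic form of $\pi$. For $\lambda\vDash n$, $A_\lambda$ is the set of permutations of composition type $\lambda$ and $C_\lambda:=\Omega(A_\lambda)$. $inv(x)=|\{(i,j):i<j,\ x(i)>x(j)\}|$; the Bruhat-Chevalley order on $S_n$ is the transitive closure of $x<y$ where $y$ is obtained from $x$ by swapping two entries $a_i<a_j$ at positions $i<j$ with $inv(y)=inv(x)+1$. A finite graded poset $P$ with minimum and maximum is EL-shellable if there is a map $f$ from the set of covering relations of $P$ to a totally ordered set such that in every interval $[x,y]$ of length $k>0$ there is a unique saturated chain $x=x_0<x_1<\cdots<x_k=y$ whose label sequence $(f(x_0,x_1),\dots,f(x_{k-1},x_k))$ is weakly increasing, and this sequence is lexicographically smallest among the label sequences of all saturated chains from $x$ to $y$. -}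

module Defs where

open import Level using (0ℓ)
open import Data.Nat as ℕ using (ℕ; zero; suc; _+_)
open import Data.Fin as Fin using (Fin)
open import Data.Fin.Properties using (_<?_)
open import Data.Vec as Vec using (Vec; lookup; _[_]≔_; toList)
open import Data.List as List using (List; []; _∷_; _++_; [_]; length; map; concat; filter)
open import Data.Nat.ListAction using (sum)
open import Data.List.Relation.Unary.All using (All)
open import Data.List.Relation.Unary.Unique.Propositional using (Unique)
open import Data.List.Relation.Unary.Linked using (Linked)
open import Data.List.Membership.Propositional using (_∈_)
open import Data.Product using (Σ; ∃; ∃-syntax; _×_; _,_; proj₁; proj₂)
open import Data.Sum using (_⊎_)
open import Data.Unit using (⊤)
open import Data.Empty using (⊥)
open import Relation.Nullary using (¬_)
open import Relation.Binary.PropositionalEquality using (_≡_; _≢_)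
open import Relation.Binary.Bundles using (TotalOrder)
open import Relation.Binary.Construct.Closure.ReflexiveTransitive using (Star)

-- Convention: [n] is represented by Fin n (entries 0..n-1 instead of 1..n).
-- A permutation of [n] in one-line notation: a word x : Vec (Fin n) n,
-- x(i) = lookup x i, with pairwise distinct entries.

Word : ℕ → Set
Word n = Vec (Fin n) n

IsPerm : ∀ {n} → Word n → Set
IsPerm x = Unique (toList x)

IsComposition : ℕ → List ℕ → Set
IsComposition n c = All (λ k → 0 ℕ.< k) c × sum c ≡ n

Cycle : ℕ → Set
Cycle n = Fin n × List (Fin n)

cycleList : ∀ {n} → Cycle n → List (Fin n)
cycleList (a , rest) = a ∷ rest

IsCycleOf : ∀ {n} → Word n → Cycle n → Set
IsCycleOf π (a , rest) = Linked (λ u v → lookup π u ≡ v) (a ∷ rest ++ [ a ])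

StartsWithMin : ∀ {n} → Cycle n → Set
StartsWithMin (a , rest) = All (λ b → a Fin.≤ b) rest

-- cs is the standard cyclic form of π (cycles of length one included)
IsStdCyclicForm : ∀ {n} → Word n → List (Cycle n) → Set
IsStdCyclicForm {n} π cs =
  Unique (concat (map cycleList cs)) ×
  (∀ (a : Fin n) → a ∈ concat (map cycleList cs)) ×
  All (IsCycleOf π) cs ×
  All StartsWithMin cs ×
  Linked Fin._<_ (map proj₁ cs)

compositionType : ∀ {n} → List (Cycle n) → List ℕ
compositionType cs = map (λ c → length (cycleList c)) cs

IsΩ : ∀ {n} → Word n → Word n → Set
IsΩ π w = ∃[ cs ] (IsStdCyclicForm π cs × toList w ≡ concat (map cycleList cs))

InA : ∀ {n} → List ℕ → Word n → Set
InA c π = IsPerm π × ∃[ cs ] (IsStdCyclicForm π cs × compositionType cs ≡ c)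

InC : ∀ {n} → List ℕ → Word n → Set
InC c w = ∃[ π ] (InA c π × IsΩ π w)

invL : ∀ {n} → List (Fin n) → ℕ
invL [] = 0
invL (a ∷ w) = length (filter (λ b → b <? a) w) + invL w

inv : ∀ {n} → Word n → ℕ
inv x = invL (toList x)

swap : ∀ {n} → Word n → Fin n → Fin n → Word n
swap x i j = (x [ i ]≔ lookup x j) [ j ]≔ lookup x i

BruhatStep : ∀ {n} → Word n → Word n → Set
BruhatStep {n} x y = ∃[ i ] ∃[ j ] (i Fin.< j × lookup x i Fin.< lookup x j ×
                      y ≡ swap x i j × inv y ≡ suc (inv x))

_≤B_ : ∀ {n} → Word n → Word n → Set
_≤B_ = Star BruhatStep

_<B_ : ∀ {n} → Word n → Word n → Set
x <B y = x ≤B y × x ≢ y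

module SubPoset {n : ℕ} (InS : Word n → Set) where

  Cover : Word n → Word n → Set
  Cover x y = InS x × InS y × x <B y ×
              (∀ z → InS z → x <B z → z <B y → ⊥)

  -- saturated chain x = x₀ ⋖ x₁ ⋖ ... ⋖ x_k = y, given as the list x₁ … x_k
  SatChain : Word n → List (Word n) → Word n → Set
  SatChain x [] y = x ≡ y
  SatChain x (z ∷ zs) y = Cover x z × SatChain z zs y

  HasMin : Set
  HasMin = ∃[ m ] (InS m × ∀ x → InS x → m ≤B x)

  HasMax : Set
  HasMax = ∃[ M ] (InS M × ∀ x → InS x → x ≤B M)

  -- graded: all maximal chains (= saturated chains from the minimum to the
  -- maximum) have the same length
  Graded : Set
  Graded = ∀ m M → InS m → InS M → (∀ x → InS x → m ≤B x) → (∀ x → InS x → x ≤B M) →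
           ∀ zs ws → SatChain m zs M → SatChain m ws M → length zs ≡ length ws

  module Labelling (T : TotalOrder 0ℓ 0ℓ 0ℓ) where
    open TotalOrder T renaming (Carrier to L)

    labels : (Word n → Word n → L) → Word n → List (Word n) → List L
    labels f x [] = []
    labels f x (z ∷ zs) = f x z ∷ labels f z zs

    WeaklyIncreasing : List L → Set
    WeaklyIncreasing = Linked _≤_

    LexLeq : List L → List L → Set
    LexLeq [] _ = ⊤
    LexLeq (a ∷ as) [] = ⊥
    LexLeq (a ∷ as) (b ∷ bs) = (a ≤ b × ¬ (a ≈ b)) ⊎ (a ≈ b × LexLeq as bs)

    -- f is an EL-labelling (only its values on covering pairs matter)
    IsELLabelling : (Word n → Word n → L) → Set
    IsELLabelling f =
      ∀ x y → InS x → InS y → x <B y →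
      ∃[ zs ] (SatChain x zs y × WeaklyIncreasing (labels f x zs) ×
               (∀ ws → SatChain x ws y → WeaklyIncreasing (labels f x ws) → ws ≡ zs) ×
               (∀ ws → SatChain x ws y → LexLeq (labels f x zs) (labels f x ws)))

  -- finite (automatic: subset of S_n) graded poset with min and max, EL-shellable
  ELShellable : Set₁
  ELShellable = HasMin × HasMax × Graded ×
    Σ (TotalOrder 0ℓ 0ℓ 0ℓ) (λ T → Σ (Word n → Word n → TotalOrder.Carrier T)
      (λ f → Labelling.IsELLabelling T f))

{-# OPTIONS --safe #-}

-- A word lies in C_c iff it is a permutation whose entry at each block start p is smaller than all
-- later entries. Let x < y in C_c first differ at d, so x(d) < y(d), and let e > d be the first position
-- with x(d) < x(e) ≤ y(d). Exchanging x(d) and x(e) adds one inversion, stays below y by the rank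
-- criterion (the counts #{k < p : x(k) ≥ v} determine the Bruhat order), and stays in C_c. Hence the
-- covers of C_c are covers of S_n, and iterating this greedy step gives a saturated chain. Label a cover
-- by its pair of exchanged positions, ordered lexicographically. The greedy step has the smallest label
-- available below y, and a chain that passes over it can be weakly increasing no longer, since position
-- d would have to overtake the entry x(e) in a later exchange that is not a cover.

module Submission where

open import Defs
open import Level using (0ℓ)
open import Data.Nat using (ℕ; zero; suc; pred; _+_; _*_; _≤_; _<_; z≤n; s≤s; _≤?_; _<?_; _≟_)
open import Data.Nat.Properties
open import Algebra.Properties.CommutativeSemigroup +-commutativeSemigroup using (x∙yz≈y∙xz; interchange)
open import Data.Nat.ListAction using (sum)
open import Data.Bool using (Bool; true; false; T; if_then_else_)
open import Data.Bool.Properties using (T?)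
open import Data.Fin as Fin using (Fin; zero; suc; toℕ; fromℕ<)
open import Data.Fin.Properties as Fin using (toℕ-injective; toℕ-fromℕ<; fromℕ<-toℕ; toℕ<n)
open import Data.Vec as Vec using (Vec; []; _∷_; lookup; toList; tabulate; _[_]≔_)
open import Data.Vec.Properties as Vec using (lookup∘update; lookup∘update′; lookup∘tabulate; tabulate∘lookup; tabulate-cong; lookup-allFin; length-toList)
open import Data.Vec.Membership.Propositional.Properties as Vec using ()
import Data.Vec.Relation.Unary.All.Properties as VAll
open import Data.List using (List; []; _∷_; _++_; [_]; length; map; concat; filter)
open import Data.List.Properties using (map-++; length-filter; filter-accept; filter-reject)
open import Data.List.Relation.Unary.All as All using (All; []; _∷_)
import Data.List.Relation.Unary.All.Properties as All
open import Data.List.Relation.Unary.Any using (here; there)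
open import Data.List.Relation.Unary.AllPairs using ([]; _∷_)
open import Data.List.Relation.Unary.Linked as Linked using (Linked; []; [-]; _∷_)
open import Data.List.Relation.Unary.Linked.Properties using (Linked⇒All)
open import Data.List.Relation.Unary.Unique.Propositional using (Unique)
open import Data.List.Membership.Propositional using (_∈_; _∉_)
open import Data.List.Membership.Propositional.Properties using (∈-++⁺ˡ; ∈-++⁺ʳ; ∈-++⁻; ∈-map⁻; ∈-map⁺)
open import Data.Product using (∃-syntax; _×_; _,_; proj₁; proj₂)
open import Data.Product.Relation.Binary.Lex.NonStrict using (×-totalOrder)
open import Data.Sum using (_⊎_; inj₁; inj₂)
open import Data.Unit using (⊤; tt)
open import Function using (_∘_)
open import Relation.Nullary using (¬_; Dec; yes; no; does; contradiction; _×-dec_; _→-dec_; ¬?)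
open import Relation.Nullary.Decidable using (decidable-stable; map′)
open import Relation.Unary using (Decidable)
open import Relation.Binary.Definitions using (tri<; tri≈; tri>)
open import Relation.Binary.Bundles using (TotalOrder)
open import Relation.Binary.Construct.Closure.ReflexiveTransitive using (ε; _◅_; _◅◅_)
open import Relation.Binary.PropositionalEquality using (_≡_; _≢_; refl; sym; trans; cong; cong₂; subst; subst₂; ≢-sym; module ≡-Reasoning)

-- Bounded search for least witnesses

-- least P? m is m when P holds nowhere below m.
least : {P : ℕ → Set} → Decidable P → ℕ → ℕ
least P? zero = 0
least P? (suc m) = if does (P? 0) then 0 else suc (least (P? ∘ suc) m)

least-≡ : ∀ {P : ℕ → Set} (P? : Decidable P) {m d} → d < m → P d → (∀ k → k < d → ¬ P k) → least P? m ≡ d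
least-≡ P? {suc m} {zero} _ Pd _ with P? 0
... | yes _ = refl
... | no ¬p = contradiction Pd ¬p
least-≡ P? {suc m} {suc d} (s≤s d<m) Pd ¬P with P? 0
... | yes p = contradiction p (¬P 0 (s≤s z≤n))
... | no _ = cong suc (least-≡ (P? ∘ suc) d<m Pd (λ k k<d → ¬P (suc k) (s≤s k<d)))

least-∃ : ∀ {P : ℕ → Set} → Decidable P → ∀ m → P m → ∃[ d ] (P d × (∀ k → k < d → ¬ P k))
least-∃ P? zero Pm = 0 , Pm , λ _ ()
least-∃ P? (suc m) Pm with P? 0
... | yes p = 0 , p , λ _ ()
... | no ¬p with least-∃ (P? ∘ suc) m Pm
... | d , Pd , ¬P = suc d , Pd , λ { zero _ → ¬p ; (suc k) (s≤s k<d) → ¬P k k<d }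

-- Rank functions

count : ∀ {P : Set} → Dec P → ℕ
count (yes _) = 1
count (no _) = 0

ind : ℕ → ℕ → ℕ
ind v a = count (v ≤? a)

ind-yes : ∀ {v a} → v ≤ a → ind v a ≡ 1
ind-yes {v} {a} v≤a with v ≤? a
... | yes _ = refl
... | no v≰a = contradiction v≤a v≰a

ind-no : ∀ {v a} → a < v → ind v a ≡ 0
ind-no {v} {a} a<v with v ≤? a
... | yes v≤a = contradiction v≤a (<⇒≱ a<v)
... | no _ = refl

ind-mono : ∀ {v w a b} → w ≤ v → a ≤ b → ind v a ≤ ind w b
ind-mono {v} {w} {a} {b} w≤v a≤b with v ≤? a
... | yes v≤a = ≤-reflexive (sym (ind-yes (≤-trans w≤v (≤-trans v≤a a≤b))))
... | no _ = z≤n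

ind-≢ : ∀ {v a} → a ≢ v → ind v a ≤ ind (suc v) a
ind-≢ {v} {a} a≢v with v ≤? a
... | yes v≤a = ≤-reflexive (sym (ind-yes (≤∧≢⇒< v≤a (≢-sym a≢v))))
... | no _ = z≤n

-- rank X p v = #{ k < p : v ≤ X k }
rank : (ℕ → ℕ) → ℕ → ℕ → ℕ
rank X zero v = 0
rank X (suc p) v = ind v (X p) + rank X p v

infix 4 _≼_
-- The rank criterion for the Bruhat order. `≤B⇒≼` gives one direction for all words; `≼⇒≤B` gives
-- the other inside the subposet.
_≼_ : (ℕ → ℕ) → (ℕ → ℕ) → Set
X ≼ Y = ∀ p v → rank X p v ≤ rank Y p v

rank-cong : ∀ {X Y} p v → (∀ k → k < p → X k ≡ Y k) → rank X p v ≡ rank Y p v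
rank-cong zero v eq = refl
rank-cong (suc p) v eq =
  cong₂ _+_ (cong (ind v) (eq p ≤-refl)) (rank-cong p v λ k k<p → eq k (m<n⇒m<1+n k<p))

record Swapped (X Z : ℕ → ℕ) (i j : ℕ) : Set where
  constructor swapped
  field
    at-i : Z i ≡ X j
    at-j : Z j ≡ X i
    elsewhere : ∀ k → k ≢ i → k ≢ j → Z k ≡ X k

module _ {X Z i j} (s : Swapped X Z i j) (i<j : i < j) where
  open Swapped s

  rank-before : ∀ p v → p ≤ i → rank Z p v ≡ rank X p v
  rank-before p v p≤i = rank-cong p v λ k k<p →
    let k<i = <-≤-trans k<p p≤i in elsewhere k (<⇒≢ k<i) (<⇒≢ (<-trans k<i i<j))

  -- A prefix that contains `i` but not `j` trades `X i` for `X j`. The indicators stand on opposite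
  -- sides to avoid subtraction.
  rank-between : ∀ p v → i < p → p ≤ j → ind v (X i) + rank Z p v ≡ ind v (X j) + rank X p v
  rank-between (suc p) v (s≤s i≤p) p<j with m≤n⇒m<n∨m≡n i≤p
  ... | inj₁ i<p rewrite elsewhere p (≢-sym (<⇒≢ i<p)) (<⇒≢ p<j) =
    trans (x∙yz≈y∙xz (ind v (X i)) (ind v (X p)) _)
      (trans (cong (ind v (X p) +_) (rank-between p v i<p (<⇒≤ p<j)))
        (x∙yz≈y∙xz (ind v (X p)) (ind v (X j)) _))
  ... | inj₂ refl rewrite at-i | rank-before p v ≤-refl = x∙yz≈y∙xz (ind v (X i)) (ind v (X j)) _

  rank-after : ∀ p v → j < p → rank Z p v ≡ rank X p v
  rank-after (suc p) v (s≤s j≤p) with m≤n⇒m<n∨m≡n j≤p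
  ... | inj₁ j<p = cong₂ _+_
    (cong (ind v) (elsewhere p (≢-sym (<⇒≢ (<-trans i<j j<p))) (≢-sym (<⇒≢ j<p))))
    (rank-after p v j<p)
  ... | inj₂ refl rewrite at-j = rank-between p v i<j ≤-refl

  swap-≼ : X i < X j → X ≼ Z
  swap-≼ Xi<Xj p v with p ≤? i | p ≤? j
  ... | yes p≤i | _ = ≤-reflexive (sym (rank-before p v p≤i))
  ... | no p≰i | yes p≤j = +-cancelˡ-≤ (ind v (X i)) _ _
    (≤-trans (+-monoˡ-≤ (rank X p v) (ind-mono {v} ≤-refl (<⇒≤ Xi<Xj)))
      (≤-reflexive (sym (rank-between p v (≰⇒> p≰i) p≤j))))
  ... | no _ | no p≰j = ≤-reflexive (sym (rank-after p v (≰⇒> p≰j)))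

-- A cover only has to exclude intermediate entries between `X d` and `X e`. Here `gap` excludes
-- them up to `Y d`, and this surplus keeps the exchanged word below `Y`.
record Greedy (X Y : ℕ → ℕ) (d e : ℕ) : Set where
  field
    agree : ∀ k → k < d → X k ≡ Y k
    d<e : d < e
    above : X d < X e
    bounded : X e ≤ Y d
    gap : ∀ k → d < k → k < e → X d < X k → Y d < X k

-- Otherwise the prefix ending at `d`, with threshold `X d`, would have rank one larger in `X` than
-- in `Y`.
≼-first : ∀ {X Y d} → X ≼ Y → (∀ k → k < d → X k ≡ Y k) → X d ≤ Y d
≼-first {X} {Y} {d} X≼Y agree with X d ≤? Y d
... | yes p = p
... | no ¬p = contradiction (X≼Y (suc d) (X d))
  (<⇒≱ (≤-reflexive (sym (trans (cong (_+ rank X d (X d)) (ind-yes ≤-refl))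
    (cong suc (trans (rank-cong d (X d) agree) (cong (_+ rank Y d (X d)) (sym (ind-no (≰⇒> ¬p))))))))))

module _ {X Y Z d e} (g : Greedy X Y d e) (s : Swapped X Z d e) where
  open Greedy g

  -- Between d and e, the entries of X exceeding Y d are exactly those exceeding X d.
  gap-ranks : ∀ p v → d < p → p ≤ e → X d < v → v ≤ Y d →
    suc (rank X p v + rank Y p (suc (Y d))) ≤ rank Y p v + rank X p (suc (Y d))
  gap-ranks (suc p) v (s≤s d≤p) p<e Xd<v v≤Yd with m≤n⇒m<n∨m≡n d≤p
  ... | inj₂ refl rewrite ind-no Xd<v | ind-yes v≤Yd | ind-no {suc (Y d)} {Y d} ≤-refl
        | ind-no {suc (Y d)} {X d} (m<n⇒m<1+n (<-≤-trans Xd<v v≤Yd))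
        | rank-cong d v agree | rank-cong d (suc (Y d)) agree = ≤-refl
  ... | inj₁ d<p = begin
      suc ((ind v (X p) + rank X p v) + (ind u (Y p) + rank Y p u))
        ≡⟨ cong suc (interchange (ind v (X p)) _ _ _) ⟩
      suc ((ind v (X p) + ind u (Y p)) + (rank X p v + rank Y p u))
        ≡⟨ sym (+-suc _ _) ⟩
      (ind v (X p) + ind u (Y p)) + suc (rank X p v + rank Y p u)
        ≤⟨ +-mono-≤ ind-le (gap-ranks p v d<p (<⇒≤ p<e) Xd<v v≤Yd) ⟩
      (ind v (Y p) + ind u (X p)) + (rank Y p v + rank X p u)
        ≡⟨ interchange (ind v (Y p)) _ _ _ ⟩
      (ind v (Y p) + rank Y p v) + (ind u (X p) + rank X p u) ∎
    where
    open ≤-Reasoning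
    u = suc (Y d)
    ind-X : ind v (X p) ≤ ind u (X p)
    ind-X with v ≤? X p
    ... | no _ = z≤n
    ... | yes v≤Xp = ≤-reflexive (sym (ind-yes (gap p d<p p<e (<-≤-trans Xd<v v≤Xp))))
    ind-le : ind v (X p) + ind u (Y p) ≤ ind v (Y p) + ind u (X p)
    ind-le = ≤-trans (+-mono-≤ ind-X (ind-mono (m≤n⇒m≤1+n v≤Yd) ≤-refl))
      (≤-reflexive (+-comm (ind u (X p)) (ind v (Y p))))

  -- Ranks change only for `d < p ≤ e` and `X d < v ≤ X e`, where they grow by one. There
  -- `gap-ranks`, combined with `X ≼ Y` at the threshold `suc (Y d)`, shows that the rank of `X` was
  -- strictly smaller than that of `Y`.
  greedy-≼ : X ≼ Y → Z ≼ Y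
  greedy-≼ X≼Y p v with p ≤? d | p ≤? e
  ... | yes p≤d | _ = ≤-trans (≤-reflexive (rank-before s d<e p v p≤d)) (X≼Y p v)
  ... | no _ | no p≰e = ≤-trans (≤-reflexive (rank-after s d<e p v (≰⇒> p≰e))) (X≼Y p v)
  ... | no p≰d | yes p≤e with v ≤? X d | v ≤? X e | rank-between s d<e p v (≰⇒> p≰d) p≤e
  ... | yes v≤Xd | yes _ | eq = ≤-trans (≤-reflexive (+-cancelˡ-≡ 1 _ _ eq)) (X≼Y p v)
  ... | yes v≤Xd | no v≰Xe | eq = contradiction (≤-trans v≤Xd (<⇒≤ above)) v≰Xe
  ... | no _ | no _ | eq = ≤-trans (≤-reflexive eq) (X≼Y p v)
  ... | no v≰Xd | yes v≤Xe | eq = ≤-trans (≤-reflexive eq)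
    (+-cancelʳ-≤ (rank Y p (suc (Y d))) _ _
      (≤-trans (gap-ranks p v (≰⇒> p≰d) p≤e (≰⇒> v≰Xd) (≤-trans v≤Xe bounded))
        (+-monoʳ-≤ (rank Y p v) (X≼Y p (suc (Y d))))))

rank-zero : ∀ X p → rank X p 0 ≡ p
rank-zero X zero = refl
rank-zero X (suc p) = cong₂ _+_ (ind-yes {0} {X p} z≤n) (rank-zero X p)

rank-avoid : ∀ {X} p v → (∀ k → k < p → X k ≢ v) → rank X p v ≤ rank X p (suc v)
rank-avoid zero v _ = z≤n
rank-avoid {X} (suc p) v avoid = +-mono-≤ (ind-≢ (avoid p ≤-refl)) (rank-avoid p v λ k k<p → avoid k (m<n⇒m<1+n k<p))

module _ {X : ℕ → ℕ} (inj : ∀ {k l} → X k ≡ X l → k ≡ l) where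

  rank-suc : ∀ p v → rank X p v ≤ suc (rank X p (suc v))
  rank-suc zero v = z≤n
  rank-suc (suc p) v with X p ≟ v
  ... | yes refl = +-mono-≤ (≤-reflexive (ind-yes ≤-refl))
    (≤-trans (rank-avoid p v λ k k<p eq → <⇒≢ k<p (inj eq)) (m≤n+m _ (ind (suc v) v)))
  ... | no Xp≢v = ≤-trans (+-mono-≤ (ind-≢ Xp≢v) (rank-suc p v)) (≤-reflexive (+-suc _ _))

  rank-lower : ∀ p v → p ≤ v + rank X p v
  rank-lower p zero = ≤-reflexive (sym (rank-zero X p))
  rank-lower p (suc v) = ≤-trans (rank-lower p v)
    (≤-trans (+-monoʳ-≤ v (rank-suc p v)) (≤-reflexive (+-suc v _)))

rank-id-zero : ∀ {p v} → p ≤ v → rank (λ k → k) p v ≡ 0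
rank-id-zero {zero} _ = refl
rank-id-zero {suc p} p<v rewrite ind-no p<v = rank-id-zero {p} (<⇒≤ p<v)

rank-id : ∀ {p v} → v ≤ p → v + rank (λ k → k) p v ≤ p
rank-id {zero} z≤n = z≤n
rank-id {suc p} {v} v≤ with m≤n⇒m<n∨m≡n v≤
... | inj₁ (s≤s v≤p) rewrite ind-yes v≤p | +-suc v (rank (λ k → k) p v) = s≤s (rank-id v≤p)
... | inj₂ refl rewrite rank-id-zero {suc p} {suc p} ≤-refl = ≤-reflexive (+-identityʳ _)

-- At most `v` entries of an injective `X` lie below `v`, so its rank is at least `p` minus `v`; the
-- identity attains this bound.
id-≼ : ∀ {X} → (∀ {k l} → X k ≡ X l → k ≡ l) → (λ k → k) ≼ X
id-≼ {X} inj p v with v ≤? p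
... | yes v≤p = +-cancelˡ-≤ v _ _ (≤-trans (rank-id v≤p) (rank-lower inj p v))
... | no v≰p = ≤-trans (≤-reflexive (rank-id-zero {p} (≰⇒≥ v≰p))) z≤n

-- Inversions under exchanging two entries

module _ {m : ℕ} where

  below : Fin m → List (Fin m) → ℕ
  below a xs = length (filter (Fin._<? a) xs)

  below-∷ : ∀ a b xs → below a (b ∷ xs) ≡ count (b Fin.<? a) + below a xs
  below-∷ a b xs with b Fin.<? a
  ... | yes b<a = cong length (filter-accept (Fin._<? a) b<a)
  ... | no b≮a = cong length (filter-reject (Fin._<? a) b≮a)

  count-< : ∀ {a b : Fin m} → b Fin.< a → count (b Fin.<? a) ≡ 1
  count-< {a} {b} b<a with b Fin.<? a
  ... | yes _ = refl
  ... | no ≮ = contradiction b<a ≮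

  count-≮ : ∀ {a b : Fin m} → ¬ b Fin.< a → count (b Fin.<? a) ≡ 0
  count-≮ {a} {b} ≮ with b Fin.<? a
  ... | yes b<a = contradiction b<a ≮
  ... | no _ = refl

  below-update : ∀ {k} c (x : Vec (Fin m) k) j a →
    count (lookup x j Fin.<? c) + below c (toList (x [ j ]≔ a)) ≡ count (a Fin.<? c) + below c (toList x)
  below-update c (b ∷ x) zero a rewrite below-∷ c a (toList x) | below-∷ c b (toList x) =
    x∙yz≈y∙xz (count (b Fin.<? c)) (count (a Fin.<? c)) _
  below-update c (b ∷ x) (suc j) a rewrite below-∷ c b (toList (x [ j ]≔ a)) | below-∷ c b (toList x) =
    trans (x∙yz≈y∙xz (count (lookup x j Fin.<? c)) (count (b Fin.<? c)) _)
      (trans (cong (count (b Fin.<? c) +_) (below-update c x j a))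
        (x∙yz≈y∙xz (count (b Fin.<? c)) (count (a Fin.<? c)) _))

  -- The case of `invL-exchange` where the smaller entry `a` is the head and `x` the tail. Each
  -- entry before `j` lies below both exchanged values or above both, so its comparisons with them
  -- contribute the same; the new inversion is that of the exchanged pair.
  invL-replace : ∀ {k} (x : Vec (Fin m) k) j a → a Fin.< lookup x j →
    (∀ l → l Fin.< j → lookup x l Fin.< a ⊎ lookup x j Fin.< lookup x l) →
    below (lookup x j) (toList (x [ j ]≔ a)) + invL (toList (x [ j ]≔ a)) ≡ suc (below a (toList x) + invL (toList x))
  invL-replace (b ∷ x) zero a a<b gap rewrite below-∷ b a (toList x) | below-∷ a b (toList x)
    | count-< a<b | count-≮ (<⇒≯ a<b) =
    cong suc (x∙yz≈y∙xz (below b (toList x)) (below a (toList x)) _)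
  invL-replace (c ∷ x) (suc j) a a<b gap = begin
      below b (c ∷ toList x′) + (below c (toList x′) + invL (toList x′))
        ≡⟨ cong (_+ (below c (toList x′) + invL (toList x′))) (below-∷ b c (toList x′)) ⟩
      (count (c Fin.<? b) + below b (toList x′)) + (below c (toList x′) + invL (toList x′))
        ≡⟨ interchange (count (c Fin.<? b)) _ _ _ ⟩
      (count (c Fin.<? b) + below c (toList x′)) + (below b (toList x′) + invL (toList x′))
        ≡⟨ cong₂ _+_ head-eq (invL-replace x j a a<b λ l l<j → gap (suc l) (s≤s l<j)) ⟩
      (count (c Fin.<? a) + below c (toList x)) + suc (below a (toList x) + invL (toList x))
        ≡⟨ +-suc _ _ ⟩
      suc ((count (c Fin.<? a) + below c (toList x)) + (below a (toList x) + invL (toList x)))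
        ≡⟨ cong suc (interchange (count (c Fin.<? a)) _ _ _) ⟩
      suc ((count (c Fin.<? a) + below a (toList x)) + (below c (toList x) + invL (toList x)))
        ≡⟨ cong (λ t → suc (t + (below c (toList x) + invL (toList x)))) (sym (below-∷ a c (toList x))) ⟩
      suc (below a (c ∷ toList x) + (below c (toList x) + invL (toList x))) ∎
    where
    open ≡-Reasoning
    b = lookup x j
    x′ = x [ j ]≔ a
    head-eq : count (c Fin.<? b) + below c (toList x′) ≡ count (c Fin.<? a) + below c (toList x)
    head-eq with gap zero (s≤s z≤n) | below-update c x j a
    ... | inj₁ c<a | eq rewrite count-< c<a | count-< (<-trans c<a a<b)
          | count-≮ (<⇒≯ c<a) | count-≮ (<⇒≯ (<-trans c<a a<b)) = cong suc eq
    ... | inj₂ b<c | eq rewrite count-< b<c | count-< (<-trans a<b b<c)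
          | count-≮ (<⇒≯ b<c) | count-≮ (<⇒≯ (<-trans a<b b<c)) = +-cancelˡ-≡ 1 _ _ eq

  exchange : ∀ {k} → Vec (Fin m) k → Fin k → Fin k → Vec (Fin m) k
  exchange x i j = (x [ i ]≔ lookup x j) [ j ]≔ lookup x i

  below-exchange : ∀ {k} c (x : Vec (Fin m) k) i j → i ≢ j →
    below c (toList (exchange x i j)) ≡ below c (toList x)
  below-exchange c x i j i≢j =
    +-cancelˡ-≡ (count (lookup x j Fin.<? c) + count (lookup x i Fin.<? c)) _ _ (begin
      (cj + ci) + below c (toList (exchange x i j)) ≡⟨ +-assoc cj ci _ ⟩
      cj + (ci + below c (toList (exchange x i j))) ≡⟨ x∙yz≈y∙xz cj ci _ ⟩
      ci + (cj + below c (toList (exchange x i j)))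
        ≡⟨ cong (λ t → ci + (count (t Fin.<? c) + below c (toList (exchange x i j)))) (sym (lookup∘update′ (≢-sym i≢j) x _)) ⟩
      ci + (count (lookup (x [ i ]≔ lookup x j) j Fin.<? c) + below c (toList (exchange x i j)))
        ≡⟨ cong (ci +_) (below-update c (x [ i ]≔ lookup x j) j (lookup x i)) ⟩
      ci + (ci + below c (toList (x [ i ]≔ lookup x j))) ≡⟨ cong (ci +_) (below-update c x i (lookup x j)) ⟩
      ci + (cj + below c (toList x)) ≡⟨ x∙yz≈y∙xz ci cj _ ⟩
      cj + (ci + below c (toList x)) ≡⟨ sym (+-assoc cj ci _) ⟩
      (cj + ci) + below c (toList x) ∎)
    where
    open ≡-Reasoning
    ci = count (lookup x i Fin.<? c)
    cj = count (lookup x j Fin.<? c)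

  invL-exchange : ∀ {k} (x : Vec (Fin m) k) i j → i Fin.< j → lookup x i Fin.< lookup x j →
    (∀ l → i Fin.< l → l Fin.< j → lookup x l Fin.< lookup x i ⊎ lookup x j Fin.< lookup x l) →
    invL (toList (exchange x i j)) ≡ suc (invL (toList x))
  invL-exchange (a ∷ x) zero (suc j) _ a<b gap =
    invL-replace x j a a<b λ l l<j → gap (suc l) (s≤s z≤n) (s≤s l<j)
  invL-exchange (a ∷ x) (suc i) (suc j) (s≤s i<j) a<b gap =
    trans (cong₂ _+_ (below-exchange a x i j (Fin.<⇒≢ i<j))
        (invL-exchange x i j i<j a<b λ l i<l l<j → gap (suc l) (s≤s i<l) (s≤s l<j)))
      (+-suc _ _)

  -- A crude bound, enough to make recursion along Bruhat steps terminate.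
  invL-bound : ∀ (w : List (Fin m)) → invL w ≤ length w * length w
  invL-bound [] = z≤n
  invL-bound (a ∷ w) = +-mono-≤ (m≤n⇒m≤1+n (length-filter (Fin._<? a) w))
    (≤-trans (invL-bound w) (*-monoʳ-≤ (length w) (n≤1+n (length w))))

inv-bound : ∀ {n} (x : Word n) → inv x ≤ n * n
inv-bound {n} x = subst (λ l → inv x ≤ l * l) (Vec.length-toList x) (invL-bound (toList x))

-- Permutation words as injections of the natural numbers

injective⇒surjective : ∀ {n} (f : Fin n → Fin n) → (∀ {i j} → f i ≡ f j → i ≡ j) → ∀ v → ∃[ i ] f i ≡ v
injective⇒surjective {suc n} f inj v with Fin.any? (λ i → f i Fin.≟ v)
... | yes found = found
-- Punching the missed value out of the range would inject `Fin (suc n)` into `Fin n`.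
... | no avoid = contradiction
  (Fin.injective⇒≤ {f = λ i → Fin.punchOut {i = v} {j = f i} (λ eq → avoid (i , sym eq))}
    (λ {i} {j} → inj ∘ Fin.punchOut-injective {i = v} {j = f i} {k = f j} _ _)) 1+n≰n

-- Positions beyond the word are fixed, so that a permutation word gives an injection of ℕ.
opaque
  val : ∀ {n} → Word n → ℕ → ℕ
  val {n} x k with k <? n
  ... | yes k<n = toℕ (lookup x (fromℕ< k<n))
  ... | no _ = k

toList-lookup-injective : ∀ {A : Set} {k} (x : Vec A k) → Unique (toList x) → ∀ i j → lookup x i ≡ lookup x j → i ≡ j
toList-lookup-injective (a ∷ x) (_ ∷ _) zero zero eq = refl
toList-lookup-injective (a ∷ x) (a∉ ∷ _) zero (suc j) eq = contradiction eq (VAll.lookup⁺ (VAll.toList⁻ a∉) j)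
toList-lookup-injective (a ∷ x) (a∉ ∷ _) (suc i) zero eq = contradiction (sym eq) (VAll.lookup⁺ (VAll.toList⁻ a∉) i)
toList-lookup-injective (a ∷ x) (_ ∷ u) (suc i) (suc j) eq = cong suc (toList-lookup-injective x u i j eq)

toList-unique : ∀ {A : Set} {k} (x : Vec A k) → (∀ i j → lookup x i ≡ lookup x j → i ≡ j) → Unique (toList x)
toList-unique [] _ = []
toList-unique (a ∷ x) inj =
  VAll.toList⁺ (VAll.lookup⁻ λ i eq → contradiction (inj zero (suc i) eq) λ ()) ∷
  toList-unique x λ i j eq → Fin.suc-injective (inj (suc i) (suc j) eq)

module _ {n : ℕ} where

  opaque
    unfolding val

    val-toℕ : ∀ (x : Word n) i → val x (toℕ i) ≡ toℕ (lookup x i)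
    val-toℕ x i with toℕ i <? n
    ... | yes p = cong (toℕ ∘ lookup x) (fromℕ<-toℕ i p)
    ... | no ≮ = contradiction (toℕ<n i) ≮

    val-beyond : ∀ (x : Word n) {k} → n ≤ k → val x k ≡ k
    val-beyond x {k} n≤k with k <? n
    ... | yes k<n = contradiction k<n (≤⇒≯ n≤k)
    ... | no _ = refl

    val-< : ∀ (x : Word n) {k} → k < n → val x k < n
    val-< x {k} k<n with k <? n
    ... | yes p = toℕ<n _
    ... | no ≮ = contradiction k<n ≮

  position : ∀ {k} → k < n → ∃[ i ] toℕ {n} i ≡ k
  position k<n = fromℕ< k<n , toℕ-fromℕ< k<n

  val-ext : ∀ {x y : Word n} → (∀ k → val x k ≡ val y k) → x ≡ y
  val-ext {x} {y} eq = trans (sym (tabulate∘lookup x)) (trans (tabulate-cong λ i → toℕ-injective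
    (trans (sym (val-toℕ x i)) (trans (eq (toℕ i)) (val-toℕ y i)))) (tabulate∘lookup y))

  differ-< : ∀ (x y : Word n) {k} → val x k ≢ val y k → k < n
  differ-< x y {k} neq = ≰⇒> λ n≤k → neq (trans (val-beyond x n≤k) (sym (val-beyond y n≤k)))

  opaque
    differ : ∀ {x y : Word n} → x ≢ y → ∃[ d ] (val x d ≢ val y d × (∀ k → k < d → val x k ≡ val y k))
    differ {x} {y} x≢y =
      let i , xi≢yi = Fin.¬∀⟶∃¬ n (λ i → val x (toℕ i) ≡ val y (toℕ i)) (λ i → val x (toℕ i) ≟ val y (toℕ i))
                        (x≢y ∘ val-ext ∘ everywhere)
          d , neq , eq = least-∃ (λ k → ¬? (val x k ≟ val y k)) (toℕ i) xi≢yi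
      in d , neq , λ k k<d → decidable-stable (val x k ≟ val y k) (eq k k<d)
      where
      everywhere : (∀ (i : Fin n) → val x (toℕ i) ≡ val y (toℕ i)) → ∀ k → val x k ≡ val y k
      everywhere eq k with <-≤-connex k n
      ... | inj₁ k<n = let i , toℕi≡k = position k<n in subst (λ k → val x k ≡ val y k) toℕi≡k (eq i)
      ... | inj₂ n≤k = trans (val-beyond x n≤k) (sym (val-beyond y n≤k))

  Inj : Word n → Set
  Inj x = ∀ {k l} → val x k ≡ val x l → k ≡ l

  perm⇒inj : ∀ {x : Word n} → IsPerm x → Inj x
  perm⇒inj {x} u {k} {l} eq with <-≤-connex k n | <-≤-connex l n
  ... | inj₁ k<n | inj₂ n≤l =
    contradiction (val-< x k<n) (≤⇒≯ (≤-trans n≤l (≤-reflexive (trans (sym (val-beyond x n≤l)) (sym eq)))))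
  ... | inj₂ n≤k | inj₁ l<n =
    contradiction (val-< x l<n) (≤⇒≯ (≤-trans n≤k (≤-reflexive (trans (sym (val-beyond x n≤k)) eq))))
  ... | inj₂ n≤k | inj₂ n≤l = trans (sym (val-beyond x n≤k)) (trans eq (val-beyond x n≤l))
  ... | inj₁ k<n | inj₁ l<n with position k<n | position l<n
  ... | i , refl | j , refl = cong toℕ (toList-lookup-injective x u i j
    (toℕ-injective (trans (sym (val-toℕ x i)) (trans eq (val-toℕ x j)))))

  inj⇒perm : ∀ {x : Word n} → Inj x → IsPerm x
  inj⇒perm {x} inj = toList-unique x λ i j eq → toℕ-injective
    (inj (trans (val-toℕ x i) (trans (cong toℕ eq) (sym (val-toℕ x j)))))

  opaque
    surjective : ∀ {x : Word n} → Inj x → ∀ v → ∃[ k ] val x k ≡ v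
    surjective {x} inj v with <-≤-connex v n
    ... | inj₂ n≤v = v , val-beyond x n≤v
    ... | inj₁ v<n =
      let i , eq = injective⇒surjective (lookup x) (toList-lookup-injective x (inj⇒perm {x} inj) _ _) (fromℕ< v<n)
      in toℕ i , trans (val-toℕ x i) (trans (cong toℕ eq) (toℕ-fromℕ< v<n))

  swap-swapped : ∀ (x : Word n) {i j} → i ≢ j → Swapped (val x) (val (swap x i j)) (toℕ i) (toℕ j)
  swap-swapped x {i} {j} i≢j = swapped
    (trans (val-toℕ _ i) (trans (cong toℕ at-i) (sym (val-toℕ x j))))
    (trans (val-toℕ _ j) (trans (cong toℕ (lookup∘update j (x [ i ]≔ lookup x j) _)) (sym (val-toℕ x i))))
    elsewhere
    where
    at-i : lookup (swap x i j) i ≡ lookup x j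
    at-i = trans (lookup∘update′ i≢j (x [ i ]≔ lookup x j) _) (lookup∘update i x _)
    elsewhere : ∀ k → k ≢ toℕ i → k ≢ toℕ j → val (swap x i j) k ≡ val x k
    elsewhere k k≢i k≢j with <-≤-connex k n
    ... | inj₂ n≤k = trans (val-beyond (swap x i j) n≤k) (sym (val-beyond x n≤k))
    ... | inj₁ k<n with position k<n
    ... | l , refl = trans (val-toℕ _ l) (trans (cong toℕ (trans
      (lookup∘update′ (k≢j ∘ cong toℕ) (x [ i ]≔ lookup x j) _)
      (lookup∘update′ (k≢i ∘ cong toℕ) x _))) (sym (val-toℕ x l)))

-- Exchanges and minima at prescribed positions

module _ {X Z i j} (s : Swapped X Z i j) where
  open Swapped s

  Swapped-injective : i ≢ j → (∀ {k l} → X k ≡ X l → k ≡ l) → ∀ {k l} → Z k ≡ Z l → k ≡ l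
  Swapped-injective i≢j inj {k} {l} eq with k ≟ i | k ≟ j | l ≟ i | l ≟ j
  ... | yes refl | _ | yes refl | _ = refl
  ... | _ | yes refl | _ | yes refl = refl
  ... | yes refl | _ | no _ | yes refl = contradiction (inj (trans (sym at-j) (trans (sym eq) at-i))) i≢j
  ... | no _ | yes refl | yes refl | _ = contradiction (inj (trans (sym at-j) (trans eq at-i))) i≢j
  ... | yes refl | _ | no l≢i | no l≢j =
    contradiction (inj (trans (sym (elsewhere l l≢i l≢j)) (trans (sym eq) at-i))) l≢j
  ... | no _ | yes refl | no l≢i | no l≢j =
    contradiction (inj (trans (sym (elsewhere l l≢i l≢j)) (trans (sym eq) at-j))) l≢i
  ... | no k≢i | no k≢j | yes refl | _ =
    contradiction (inj (trans (sym (elsewhere k k≢i k≢j)) (trans eq at-i))) k≢j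
  ... | no k≢i | no k≢j | no _ | yes refl =
    contradiction (inj (trans (sym (elsewhere k k≢i k≢j)) (trans eq at-j))) k≢i
  ... | no k≢i | no k≢j | no l≢i | no l≢j =
    inj (trans (sym (elsewhere k k≢i k≢j)) (trans eq (elsewhere l l≢i l≢j)))

  Swapped-functional : ∀ {Z′} → Swapped X Z′ i j → ∀ k → Z k ≡ Z′ k
  Swapped-functional s′ k with k ≟ i | k ≟ j
  ... | yes refl | _ = trans at-i (sym (Swapped.at-i s′))
  ... | no _ | yes refl = trans at-j (sym (Swapped.at-j s′))
  ... | no k≢i | no k≢j = trans (elsewhere k k≢i k≢j) (sym (Swapped.elsewhere s′ k k≢i k≢j))

-- For `S` the set of block starts this describes the permutation words of C_c. The fixed positions
-- beyond a word satisfy it automatically.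
MinimumAt : (ℕ → Set) → (ℕ → ℕ) → Set
MinimumAt S X = ∀ p q → S p → p < q → X p < X q

module _ {S : ℕ → Set} {X Y Z d e} (injX : ∀ {k l} → X k ≡ X l → k ≡ l) (surjY : ∀ v → ∃[ k ] Y k ≡ v)
  (g : Greedy X Y d e) (s : Swapped X Z d e) where
  open Greedy g
  open Swapped s

  -- The entry at a position in S is determined by the preceding ones, so X and Y cannot first differ there.
  greedy-position : MinimumAt S Y → ¬ S d
  greedy-position minY Sd with surjY (X d)
  ... | k , Yk≡Xd with <-cmp k d
  ... | tri< k<d _ _ = <⇒≢ k<d (injX (trans (agree k k<d) Yk≡Xd))
  ... | tri≈ _ refl _ = <⇒≢ (<-≤-trans above bounded) (sym Yk≡Xd)
  ... | tri> _ _ d<k = <-asym (<-≤-trans above bounded) (subst (Y d <_) Yk≡Xd (minY d k Sd d<k))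

  -- The delicate case is a start `p` between `d` and `e`, behind which the smaller entry `X d`
  -- arrives. If `X d < X p`, then `gap` gives `Y d < X p`, while minimality of `X p` gives
  -- `X p < X e ≤ Y d`.
  greedy-MinimumAt : MinimumAt S X → MinimumAt S Y → MinimumAt S Z
  greedy-MinimumAt minX minY p q Sp p<q with <-cmp p d
  ... | tri≈ _ refl _ = contradiction Sp (greedy-position minY)
  ... | tri< p<d _ _ rewrite elsewhere p (<⇒≢ p<d) (<⇒≢ (<-trans p<d d<e)) with q ≟ d | q ≟ e
  ... | yes refl | _ rewrite at-i = minX p e Sp (<-trans p<d d<e)
  ... | no _ | yes refl rewrite at-j = minX p d Sp p<d
  ... | no q≢d | no q≢e rewrite elsewhere q q≢d q≢e = minX p q Sp p<q
  greedy-MinimumAt minX minY p q Sp p<q | tri> _ _ d<p with <-cmp p e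
  ... | tri> _ _ e<p rewrite elsewhere p (≢-sym (<⇒≢ d<p)) (≢-sym (<⇒≢ e<p))
        | elsewhere q (≢-sym (<⇒≢ (<-trans d<p p<q))) (≢-sym (<⇒≢ (<-trans e<p p<q))) = minX p q Sp p<q
  ... | tri≈ _ refl _ rewrite at-j | elsewhere q (≢-sym (<⇒≢ (<-trans d<p p<q))) (≢-sym (<⇒≢ p<q)) =
        <-trans above (minX p q Sp p<q)
  ... | tri< p<e _ _ rewrite elsewhere p (≢-sym (<⇒≢ d<p)) (<⇒≢ p<e) with q ≟ e
  ... | no q≢e rewrite elsewhere q (≢-sym (<⇒≢ (<-trans d<p p<q))) q≢e = minX p q Sp p<q
  ... | yes refl rewrite at-j with <-cmp (X p) (X d)
  ... | tri< Xp<Xd _ _ = Xp<Xd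
  ... | tri≈ _ Xp≡Xd _ = contradiction (injX Xp≡Xd) (≢-sym (<⇒≢ d<p))
  ... | tri> _ _ Xd<Xp = contradiction (<-trans (minX p e Sp p<e) (≤-<-trans bounded (gap p d<p p<e Xd<Xp))) (<-irrefl refl)

-- The labelling by exchanged positions

Label : TotalOrder 0ℓ 0ℓ 0ℓ
Label = ×-totalOrder ≤-decTotalOrder ≤-totalOrder

module _ {n : ℕ} where

  opaque
    -- The value of `y` at `d` occurs in `x`, and only after `d` because the prefixes agree. So the
    -- search succeeds, and leastness of its result is `gap`.
    greedy-∃ : ∀ {x y : Word n} {d} → Inj x → Inj y → (∀ k → k < d → val x k ≡ val y k) →
      val x d < val y d → ∃[ e ] Greedy (val x) (val y) d e
    greedy-∃ {x} {y} {d} injx injy agree Xd<Yd with surjective injx (val y d)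
    ... | k , Xk≡Yd with <-cmp k d
    ... | tri< k<d _ _ = contradiction (injy (trans (sym (agree k k<d)) Xk≡Yd)) (<⇒≢ k<d)
    ... | tri≈ _ refl _ = contradiction Xk≡Yd (<⇒≢ Xd<Yd)
    ... | tri> _ _ d<k with least-∃ (λ e → d <? e ×-dec val x d <? val x e ×-dec val x e ≤? val y d) k
                              (d<k , subst (val x d <_) (sym Xk≡Yd) Xd<Yd , ≤-reflexive Xk≡Yd)
    ... | e , (d<e , above , bounded) , least = e , record
      { agree = agree ; d<e = d<e ; above = above ; bounded = bounded
      ; gap = λ k d<k k<e Xd<Xk → ≰⇒> λ Xk≤Yd → least k k<e (d<k , Xd<Xk , Xk≤Yd) }

  -- Beyond the word `x` fixes `e`, and `e` would exceed the entry of `y` at `d`, against `bounded`.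
  greedy-< : ∀ {x y : Word n} {d e} → Greedy (val x) (val y) d e → e < n
  greedy-< {x} {y} {d} {e} g = ≰⇒> λ n≤e → ≤⇒≯ bounded (subst (val y d <_) (sym (val-beyond x n≤e)) (Yd<e n≤e))
    where
    open Greedy g
    Yd<e : n ≤ e → val y d < e
    Yd<e n≤e with <-≤-connex d n
    ... | inj₁ d<n = <-≤-trans (val-< y d<n) n≤e
    ... | inj₂ n≤d rewrite val-beyond y n≤d = d<e

  opaque
    greedy-step : ∀ {x y : Word n} {d e} → Inj x → Greedy (val x) (val y) d e →
      ∃[ z ] (BruhatStep x z × Swapped (val x) (val z) d e)
    greedy-step {x} {y} {d} {e} inj g with position (<-trans (Greedy.d<e g) (greedy-< {x} {y} g)) | position (greedy-< {x} {y} g)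
    ... | i , refl | j , refl =
      swap x i j ,
      (i , j , d<e , subst₂ _<_ (val-toℕ x i) (val-toℕ x j) above , refl ,
        invL-exchange x i j d<e (subst₂ _<_ (val-toℕ x i) (val-toℕ x j) above) outside) ,
      swap-swapped x (Fin.<⇒≢ d<e)
      where
      open Greedy g
      outside : ∀ l → i Fin.< l → l Fin.< j → lookup x l Fin.< lookup x i ⊎ lookup x j Fin.< lookup x l
      outside l i<l l<j with <-cmp (val x (toℕ l)) (val x (toℕ i))
      ... | tri< xl<xi _ _ = inj₁ (subst₂ _<_ (val-toℕ x l) (val-toℕ x i) xl<xi)
      ... | tri≈ _ eq _ = contradiction (inj eq) (≢-sym (<⇒≢ i<l))
      ... | tri> _ _ xi<xl = inj₂ (subst₂ _<_ (val-toℕ x j) (val-toℕ x l) (≤-<-trans bounded (gap (toℕ l) i<l l<j xi<xl)))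

  lookup⇒MinimumAt : ∀ {S} {x : Word n} →
    (∀ p q → S (toℕ p) → p Fin.< q → lookup x p Fin.< lookup x q) → MinimumAt S (val x)
  lookup⇒MinimumAt {x = x} m p q Sp p<q with <-≤-connex p n | <-≤-connex q n
  ... | inj₁ p<n | inj₂ n≤q = <-≤-trans (val-< x p<n) (≤-trans n≤q (≤-reflexive (sym (val-beyond x n≤q))))
  ... | inj₂ n≤p | inj₁ q<n = contradiction (<-trans p<q q<n) (≤⇒≯ n≤p)
  ... | inj₂ n≤p | inj₂ n≤q = subst₂ _<_ (sym (val-beyond x n≤p)) (sym (val-beyond x n≤q)) p<q
  ... | inj₁ p<n | inj₁ q<n with position p<n | position q<n
  ... | i , refl | j , refl = subst₂ _<_ (sym (val-toℕ x i)) (sym (val-toℕ x j)) (m i j Sp p<q)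

  MinimumAt⇒lookup : ∀ {S} {x : Word n} → MinimumAt S (val x) →
    ∀ p q → S (toℕ p) → p Fin.< q → lookup x p Fin.< lookup x q
  MinimumAt⇒lookup {x = x} m p q Sp p<q = subst₂ _<_ (val-toℕ x p) (val-toℕ x q) (m (toℕ p) (toℕ q) Sp p<q)

  step-≼ : ∀ {x y : Word n} → BruhatStep x y → val x ≼ val y
  step-≼ {x} (i , j , i<j , xi<xj , refl , _) =
    swap-≼ (swap-swapped x (Fin.<⇒≢ i<j)) i<j (subst₂ _<_ (sym (val-toℕ x i)) (sym (val-toℕ x j)) xi<xj)

  ≤B⇒≼ : ∀ {x y : Word n} → x ≤B y → val x ≼ val y
  ≤B⇒≼ ε p v = ≤-refl
  ≤B⇒≼ (s ◅ ss) p v = ≤-trans (step-≼ s p v) (≤B⇒≼ ss p v)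

  step-inv : ∀ {x y : Word n} → BruhatStep x y → inv y ≡ suc (inv x)
  step-inv (_ , _ , _ , _ , _ , eq) = eq

  ≤B⇒inv≤ : ∀ {x y : Word n} → x ≤B y → inv x ≤ inv y
  ≤B⇒inv≤ ε = ≤-refl
  ≤B⇒inv≤ (s ◅ ss) = <⇒≤ (≤-trans (≤-reflexive (sym (step-inv s))) (≤B⇒inv≤ ss))

  <B⇒inv< : ∀ {x y : Word n} → x <B y → inv x < inv y
  <B⇒inv< (ε , x≢x) = contradiction refl x≢x
  <B⇒inv< (s ◅ ss , _) = ≤-trans (≤-reflexive (sym (step-inv s))) (≤B⇒inv≤ ss)

  _≟ʷ_ : (x y : Word n) → Dec (x ≡ y)
  _≟ʷ_ = Vec.≡-dec Fin._≟_

  -- A labelling takes arbitrary pairs of words, so the exchanged positions are read off as the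
  -- first two differences. The default `n` marks a missing difference.
  first-difference : Word n → Word n → ℕ
  first-difference x y = least (λ k → ¬? (val x k ≟ val y k)) n

  second-difference : Word n → Word n → ℕ
  second-difference x y = least (λ k → first-difference x y <? k ×-dec ¬? (val x k ≟ val y k)) n

  opaque
    label : Word n → Word n → ℕ × ℕ
    label x y = first-difference x y , second-difference x y

    label-def : ∀ x y → label x y ≡ (first-difference x y , second-difference x y)
    label-def x y = refl

  -- n * n bounds the number of inversions, so k with n * n ≤ k + inv x bounds the number of steps above x.
  step-fuel : ∀ {x y : Word n} {k} → BruhatStep x y → n * n ≤ suc k + inv x → n * n ≤ k + inv y
  step-fuel {k = k} s h rewrite step-inv s = ≤-trans h (≤-reflexive (sym (+-suc k _)))

  step-exhausted : ∀ {x y : Word n} → BruhatStep x y → ¬ (n * n ≤ inv x)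
  step-exhausted {y = y} s h = <⇒≱ (≤-reflexive (sym (step-inv s))) (≤-trans (inv-bound y) h)

-- EL-shellability of permutation words with prescribed minima

module ELProof {n : ℕ} (InS : Word n → Set) {S : ℕ → Set} (S? : ∀ p → Dec (S p))
  (sound : ∀ {x} → InS x → Inj x × MinimumAt S (val x))
  (complete : ∀ {x} → Inj x → MinimumAt S (val x) → InS x) where

  open SubPoset InS
  open Labelling Label
  open TotalOrder Label using () renaming (_≤_ to _⊑_; trans to ⊑-trans)

  opaque
    -- The order enters through the first difference alone, so that `≤B-maximal` can apply this to
    -- words not yet known to be comparable.
    toward : ∀ {x y d} → InS x → InS y → (∀ k → k < d → val x k ≡ val y k) → val x d < val y d →
      ∃[ e ] ∃[ z ] (Greedy (val x) (val y) d e × BruhatStep x z × Swapped (val x) (val z) d e × InS z)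
    toward {x} {y} x∈ y∈ agree Xd<Yd with sound x∈ | sound y∈
    ... | injx , minx | injy , miny with greedy-∃ {x = x} {y} injx injy agree Xd<Yd
    ... | e , g with greedy-step {y = y} injx g
    ... | z , step , s = e , z , g , step , s ,
      complete (Swapped-injective s (<⇒≢ (Greedy.d<e g)) injx)
        (greedy-MinimumAt injx (surjective injy) g s minx miny)

    descend : ∀ {x y} → InS x → InS y → val x ≼ val y → x ≢ y →
      ∃[ d ] ∃[ e ] ∃[ z ] (Greedy (val x) (val y) d e × BruhatStep x z × Swapped (val x) (val z) d e × InS z × val z ≼ val y)
    descend x∈ y∈ x≼y x≢y with differ x≢y
    ... | d , neq , agree with toward x∈ y∈ agree (≤∧≢⇒< (≼-first x≼y agree) neq)
    ... | e , z , g , step , s , z∈ = d , e , z , g , step , s , z∈ , greedy-≼ g s x≼y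

  ≼⇒≤B-within : ∀ k {x y} → n * n ≤ k + inv x → InS x → InS y → val x ≼ val y → x ≤B y
  ≼⇒≤B-within k {x} {y} h x∈ y∈ x≼y with x ≟ʷ y
  ... | yes refl = ε
  ... | no x≢y with descend x∈ y∈ x≼y x≢y
  ≼⇒≤B-within zero h _ _ _ | no _ | _ , _ , _ , _ , step , _ = contradiction h (step-exhausted step)
  ≼⇒≤B-within (suc k) h x∈ y∈ x≼y | no _ | _ , _ , z , _ , step , _ , z∈ , z≼y =
    step ◅ ≼⇒≤B-within k (step-fuel step h) z∈ y∈ z≼y

  ≼⇒≤B : ∀ {x y} → InS x → InS y → val x ≼ val y → x ≤B y
  ≼⇒≤B {x} = ≼⇒≤B-within (n * n) (m≤m+n (n * n) (inv x))

  -- Covers and their labels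

  record Covering (x y : Word n) : Set where
    field
      i j : ℕ
      i<j : i < j
      step : BruhatStep x y
      s : Swapped (val x) (val y) i j
      ascent : val x i < val x j
      gap : ∀ k → i < k → k < j → val x i < val x k → val x j < val x k
      label-≡ : label x y ≡ (i , j)

  label-swapped : ∀ {x z : Word n} {d e} → Swapped (val x) (val z) d e → d < e → val x d < val x e → label x z ≡ (d , e)
  label-swapped {x} {z} {d} {e} s d<e above = trans (label-def x z) (cong₂ _,_ first second)
    where
    open Swapped s
    neq-d : val x d ≢ val z d
    neq-d eq = <⇒≢ above (trans eq at-i)
    neq-e : val x e ≢ val z e
    neq-e eq = <⇒≢ above (sym (trans eq at-j))
    first : first-difference x z ≡ d
    first = least-≡ (λ k → ¬? (val x k ≟ val z k)) (differ-< x z neq-d) neq-d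
      λ k k<d neq → neq (sym (elsewhere k (<⇒≢ k<d) (<⇒≢ (<-trans k<d d<e))))
    second : second-difference x z ≡ e
    second = least-≡ (λ k → first-difference x z <? k ×-dec ¬? (val x k ≟ val z k)) (differ-< x z neq-e)
      (subst (_< e) (sym first) d<e , neq-e)
      λ { k k<e (d<k , neq) → neq (sym (elsewhere k (≢-sym (<⇒≢ (subst (_< k) first d<k))) (<⇒≢ k<e))) }

  opaque
    -- The greedy word `z` lies in the subposet, strictly above `x` and below `y`, so a cover forces
    -- `z ≡ y`. Every cover is therefore a greedy exchange and a single Bruhat step.
    cover⇒covering : ∀ {x y} → Cover x y → Covering x y
    cover⇒covering {x} {y} (x∈ , y∈ , (x≤y , x≢y) , none) with descend x∈ y∈ (≤B⇒≼ x≤y) x≢y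
    ... | d , e , z , g , step , s , z∈ , z≼y with z ≟ʷ y
    ... | no z≢y = contradiction (≼⇒≤B z∈ y∈ z≼y , z≢y)
      (none z z∈ (step ◅ ε , λ eq → <⇒≢ (≤-reflexive (sym (step-inv step))) (cong inv eq)))
    ... | yes refl = record
      { i = d ; j = e ; i<j = d<e ; step = step ; s = s ; ascent = above
      ; gap = λ k d<k k<e Xd<Xk → subst (_< val x k) (Swapped.at-i s) (gap k d<k k<e Xd<Xk)
      ; label-≡ = label-swapped s d<e above }
      where open Greedy g

  -- An element strictly between would have its inversion number strictly between two consecutive
  -- integers.
  step⇒cover : ∀ {x y} → InS x → InS y → BruhatStep x y → Cover x y
  step⇒cover x∈ y∈ step = x∈ , y∈ ,
    (step ◅ ε , λ eq → <⇒≢ (≤-reflexive (sym (step-inv step))) (cong inv eq)) ,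
    λ z _ x<z z<y → <⇒≱ (≤-<-trans (<B⇒inv< x<z) (<B⇒inv< z<y)) (≤-reflexive (step-inv step))

  cover-≤B : ∀ {x y} → Cover x y → x ≤B y
  cover-≤B (_ , _ , (x≤y , _) , _) = x≤y

  chain-≤B : ∀ {x y} zs → SatChain x zs y → x ≤B y
  chain-≤B [] refl = ε
  chain-≤B (z ∷ zs) (c , cs) = cover-≤B c ◅◅ chain-≤B zs cs

  chain-length : ∀ {x y} zs → SatChain x zs y → length zs + inv x ≡ inv y
  chain-length [] refl = refl
  chain-length {x} (z ∷ zs) (c , cs) = trans (sym (+-suc (length zs) (inv x)))
    (trans (cong (length zs +_) (sym (step-inv (Covering.step (cover⇒covering c))))) (chain-length zs cs))

  loop-free : ∀ {x} zs → SatChain x zs x → zs ≡ []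
  loop-free [] _ = refl
  loop-free {x} (z ∷ zs) cs = contradiction (chain-length (z ∷ zs) cs) (≢-sym (<⇒≢ (s≤s (m≤n+m (inv x) (length zs)))))

  -- An exchange starting before `d`, or one of `d` with a position before `e`, would make the first
  -- changed entry of `w` exceed that of `y`, against `≼-first`. The hypotheses fit both the start
  -- of a greedy step and the word it reaches.
  label-bound : ∀ {z w y : Word n} {d e} (c : Covering z w) → val w ≼ val y → (∀ k → k < d → val z k ≡ val y k) →
    (∀ k → d < k → k < e → val z d < val z k → val y d < val z k) → (d , e) ⊑ (Covering.i c , Covering.j c)
  label-bound {z} {w} {y} {d} {e} c w≼y agree guard with <-cmp (Covering.i c) d
  ... | tri> _ _ d<i = inj₁ (<⇒≤ d<i , <⇒≢ d<i)
  ... | tri< i<d _ _ = contradiction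
      (≼-first w≼y λ k k<i → trans (elsewhere k (<⇒≢ k<i) (<⇒≢ (<-trans k<i i<j))) (agree k (<-trans k<i i<d)))
      (<⇒≱ (subst₂ _<_ (agree i i<d) (sym at-i) ascent))
    where open Covering c
          open Swapped s
  ... | tri≈ _ refl _ = inj₂ (refl , ≮⇒≥ λ j<e → <⇒≱ (guard j i<j j<e ascent)
      (subst (_≤ val y d) at-i
        (≼-first w≼y λ k k<i → trans (elsewhere k (<⇒≢ k<i) (<⇒≢ (<-trans k<i i<j))) (agree k k<i))))
    where open Covering c
          open Swapped s

  -- A label holds the smaller exchanged position first, so no exchange touches `d`.
  frozen : ∀ {u y d} ws → SatChain u ws y → All (λ l → d < proj₁ l) (labels label u ws) → val y d ≡ val u d
  frozen [] refl _ = refl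
  frozen (w ∷ ws) (c , cs) (d<l ∷ ls) rewrite Covering.label-≡ (cover⇒covering c) =
    trans (frozen ws cs ls) (elsewhere _ (<⇒≢ d<l) (<⇒≢ (<-trans d<l i<j)))
    where open Covering (cover⇒covering c)
          open Swapped s

  Beyond : ℕ → ℕ → ℕ × ℕ → Set
  Beyond d e (i , j) = d < i ⊎ (d ≡ i × e < j)

  ⊑⇒fst≤ : ∀ {l m} → l ⊑ m → proj₁ l ≤ proj₁ m
  ⊑⇒fst≤ (inj₁ (i≤i′ , _)) = i≤i′
  ⊑⇒fst≤ (inj₂ (eq , _)) = ≤-reflexive eq

  ⊑-refl : ∀ {l} → l ⊑ l
  ⊑-refl = inj₂ (refl , ≤-refl)

  Beyond-⊑ : ∀ {d e l m} → Beyond d e l → l ⊑ m → Beyond d e m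
  Beyond-⊑ (inj₁ d<i) l⊑m = inj₁ (<-≤-trans d<i (⊑⇒fst≤ l⊑m))
  Beyond-⊑ (inj₂ (refl , e<j)) (inj₁ (d≤i , d≢i)) = inj₁ (≤∧≢⇒< d≤i d≢i)
  Beyond-⊑ (inj₂ (refl , e<j)) (inj₂ (refl , j≤j′)) = inj₂ (refl , <-≤-trans e<j j≤j′)

  -- Once the labels have passed (d , e), position d can no longer overtake the entry at e: a cover
  -- that exchanges d with a position beyond e may not jump over that entry.
  jump : ∀ {u y d e} ws → d < e → SatChain u ws y → WeaklyIncreasing (labels label u ws) →
    All (Beyond d e) (labels label u ws) → val u d < val u e → val y d < val u e
  jump [] d<e refl _ _ ud<ue = ud<ue
  jump {u} {y} {d} {e} (w ∷ ws) d<e (c , cs) inc (b ∷ bs) ud<ue with Linked⇒All ⊑-trans ⊑-refl inc | b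
  ... | le | inj₁ d<i = subst (_< val u e)
    (sym (frozen (w ∷ ws) (c , cs) (All.map (λ l⊑m → <-≤-trans d<i (⊑⇒fst≤ l⊑m)) le))) ud<ue
  ... | _ | inj₂ d≡i,e<j rewrite Covering.label-≡ (cover⇒covering c) with d≡i,e<j
  ... | refl , e<j = subst (val y d <_) we≡ue (jump ws d<e cs (Linked.tail inc) bs
        (subst₂ _<_ (sym at-i) (sym we≡ue) (gap e d<e e<j ud<ue)))
    where open Covering (cover⇒covering c)
          open Swapped s
          we≡ue : val w e ≡ val u e
          we≡ue = elsewhere e (≢-sym (<⇒≢ d<e)) (<⇒≢ e<j)

  lex-split : ∀ {l m} → l ⊑ m → Beyond (proj₁ l) (proj₂ l) m ⊎ l ≡ m
  lex-split (inj₁ (d≤i , d≢i)) = inj₁ (inj₁ (≤∧≢⇒< d≤i d≢i))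
  lex-split (inj₂ (refl , e≤j)) with m≤n⇒m<n∨m≡n e≤j
  ... | inj₁ e<j = inj₁ (inj₂ (refl , e<j))
  ... | inj₂ refl = inj₂ refl

  Beyond⇒< : ∀ {l m} → Beyond (proj₁ l) (proj₂ l) m → l ⊑ m × ¬ TotalOrder._≈_ Label l m
  Beyond⇒< (inj₁ d<i) = inj₁ (<⇒≤ d<i , <⇒≢ d<i) , λ eq → <⇒≢ d<i (proj₁ eq)
  Beyond⇒< (inj₂ (refl , e<j)) = inj₂ (refl , <⇒≤ e<j) , λ eq → <⇒≢ e<j (proj₂ eq)

  -- Building the increasing chain by greedy steps

  ELChain : Word n → Word n → List (Word n) → Set
  ELChain x y zs = SatChain x zs y × WeaklyIncreasing (labels label x zs) ×
    (∀ ws → SatChain x ws y → WeaklyIncreasing (labels label x ws) → ws ≡ zs) ×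
    (∀ ws → SatChain x ws y → LexLeq (labels label x zs) (labels label x ws))

  module Prepend {x y z d e zs} (x≢y : x ≢ y) (g : Greedy (val x) (val y) d e) (x⋖z : Cover x z)
    (sz : Swapped (val x) (val z) d e) (el : ELChain z y zs) where
    open Greedy g

    label-z : label x z ≡ (d , e)
    label-z = label-swapped sz d<e above

    above-y : ∀ {w} ws → SatChain w ws y → val w ≼ val y
    above-y ws cs = ≤B⇒≼ (chain-≤B ws cs)

    agree-z : ∀ k → k < d → val z k ≡ val y k
    agree-z k k<d = trans (Swapped.elsewhere sz k (<⇒≢ k<d) (<⇒≢ (<-trans k<d d<e))) (agree k k<d)

    -- Between `d` and `e` the entries are those of `x`, and `z` at `d` holds the larger exchanged
    -- entry, so `gap` applies.
    guard-z : ∀ k → d < k → k < e → val z d < val z k → val y d < val z k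
    guard-z k d<k k<e zd<zk rewrite Swapped.at-i sz | Swapped.elsewhere sz k (≢-sym (<⇒≢ d<k)) (<⇒≢ k<e) =
      gap k d<k k<e (<-trans above zd<zk)

    increasing : ∀ ws → SatChain z ws y → WeaklyIncreasing (labels label z ws) →
      WeaklyIncreasing (labels label x (z ∷ ws))
    increasing [] _ _ = [-]
    increasing (w ∷ ws) (c , cs) inc = subst₂ _⊑_ (sym label-z) (sym label-≡)
        (label-bound {y = y} (cover⇒covering c) (above-y ws cs) agree-z guard-z) ∷ inc
      where open Covering (cover⇒covering c)

    -- A first label equal to `(d , e)` determines the exchange and hence the word reached.
    compare : ∀ {w} ws → Cover x w → SatChain w ws y → Beyond d e (label x w) ⊎ w ≡ z
    compare {w} ws c cs with lex-split (label-bound {y = y} (cover⇒covering c) (above-y ws cs) agree gap)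
    ... | inj₁ b = inj₁ (subst (Beyond d e) (sym label-≡) b)
      where open Covering (cover⇒covering c)
    ... | inj₂ refl = inj₂ (val-ext (Swapped-functional s sz))
      where open Covering (cover⇒covering c)

    elChain : ELChain x y (z ∷ zs)
    elChain = let sat , inc , _ = el in (x⋖z , sat) , increasing zs sat inc , unique , minimal
      where
      uniq = proj₁ (proj₂ (proj₂ el))
      lex = proj₂ (proj₂ (proj₂ el))

      unique : ∀ ws → SatChain x ws y → WeaklyIncreasing (labels label x ws) → ws ≡ z ∷ zs
      unique [] x≡y _ = contradiction x≡y x≢y
      unique (w ∷ ws) (c , cs) inc′ with compare ws c cs
      ... | inj₂ refl = cong (z ∷_) (uniq ws cs (Linked.tail inc′))
      -- A weakly increasing chain that starts beyond `(d , e)` stays beyond it, so `jump` puts `y`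
      -- at `d` strictly below `x` at `e`, against `bounded`.
      ... | inj₁ b = contradiction
        (jump (w ∷ ws) d<e (c , cs) inc′ (All.map (Beyond-⊑ b) (Linked⇒All ⊑-trans ⊑-refl inc′)) above)
        (≤⇒≯ bounded)

      minimal : ∀ ws → SatChain x ws y → LexLeq (labels label x (z ∷ zs)) (labels label x ws)
      minimal [] x≡y = contradiction x≡y x≢y
      minimal (w ∷ ws) (c , cs) with compare ws c cs
      ... | inj₂ refl = inj₂ ((refl , refl) , lex ws cs)
      ... | inj₁ b = inj₁ (Beyond⇒< (subst (λ l → Beyond (proj₁ l) (proj₂ l) (label x w)) (sym label-z) b))

  elChain-∃ : ∀ k {x y} → n * n ≤ k + inv x → InS x → InS y → val x ≼ val y → ∃[ zs ] ELChain x y zs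
  elChain-∃ k {x} {y} h x∈ y∈ x≼y with x ≟ʷ y
  ... | yes refl = [] , refl , [] , (λ ws cs _ → loop-free ws cs) , λ _ _ → tt
  ... | no x≢y with descend x∈ y∈ x≼y x≢y
  elChain-∃ zero h _ _ _ | no _ | _ , _ , _ , _ , step , _ = contradiction h (step-exhausted step)
  elChain-∃ (suc k) h x∈ y∈ x≼y | no x≢y | d , e , z , g , step , s , z∈ , z≼y =
    let zs , el = elChain-∃ k (step-fuel step h) z∈ y∈ z≼y
    in z ∷ zs , Prepend.elChain x≢y g (step⇒cover x∈ z∈ step) s el

  isELLabelling : IsELLabelling label
  isELLabelling x y x∈ y∈ (x≤y , _) = elChain-∃ (n * n) (m≤m+n (n * n) (inv x)) x∈ y∈ (≤B⇒≼ x≤y)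

  -- Minimum, maximum and grading

  identity : Word n
  identity = Vec.allFin n

  val-identity : ∀ k → val identity k ≡ k
  val-identity k with <-≤-connex k n
  ... | inj₂ n≤k = val-beyond identity n≤k
  ... | inj₁ k<n with position k<n
  ... | i , refl = trans (val-toℕ identity i) (cong toℕ (lookup-allFin i))

  identity∈ : InS identity
  identity∈ = complete (λ {k} {l} eq → trans (sym (val-identity k)) (trans eq (val-identity l)))
    λ p q _ p<q → subst₂ _<_ (sym (val-identity p)) (sym (val-identity q)) p<q

  hasMin : HasMin
  hasMin = identity , identity∈ , λ x x∈ → ≼⇒≤B identity∈ x∈ λ p v →
    ≤-trans (≤-reflexive (rank-cong p v λ k _ → val-identity k)) (id-≼ (proj₁ (sound x∈)) p v)

  step-inj : ∀ {x y : Word n} → BruhatStep x y → Inj x → Inj y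
  step-inj {x} (i , j , i<j , _ , refl , _) = Swapped-injective (swap-swapped x (Fin.<⇒≢ i<j)) (Fin.<⇒≢ i<j ∘ toℕ-injective)

  minimumAt? : ∀ (x : Word n) → Dec (MinimumAt S (val x))
  minimumAt? x = map′ lookup⇒MinimumAt MinimumAt⇒lookup
    (Fin.all? λ p → Fin.all? λ q → S? (toℕ p) →-dec p Fin.<? q →-dec lookup x p Fin.<? lookup x q)

  -- Local maximality with respect to single steps; `≤B-maximal` turns it into a global maximum.
  Maximal : Word n → Set
  Maximal M = ∀ {z} → BruhatStep M z → ¬ InS z

  maximal : ∀ k {x} → n * n ≤ k + inv x → InS x → ∃[ M ] (InS M × Maximal M)
  maximal k {x} h x∈ with Fin.any? (λ i → Fin.any? λ j → i Fin.<? j ×-dec lookup x i Fin.<? lookup x j ×-dec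
                            inv (swap x i j) ≟ suc (inv x) ×-dec minimumAt? (swap x i j))
  ... | no none = x , x∈ , λ { (i , j , i<j , xi<xj , refl , eq) z∈ → none (i , j , i<j , xi<xj , eq , proj₂ (sound z∈)) }
  ... | yes (i , j , i<j , xi<xj , eq , min) = ascend k h
    where
    step : BruhatStep x (swap x i j)
    step = i , j , i<j , xi<xj , refl , eq
    ascend : ∀ k → n * n ≤ k + inv x → ∃[ M ] (InS M × Maximal M)
    ascend zero h = contradiction h (step-exhausted step)
    ascend (suc k) h = maximal k (step-fuel step h) (complete (step-inj step (proj₁ (sound x∈))) min)

  -- Where x and M first differ, M has the larger entry: otherwise M has a greedy step towards x.
  ≤B-maximal : ∀ k {x M} → n * n ≤ k + inv x → InS x → InS M → Maximal M → x ≤B M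
  ≤B-maximal k {x} {M} h x∈ M∈ max with x ≟ʷ M
  ... | yes refl = ε
  ... | no x≢M with differ x≢M
  ... | d , neq , agree with <-cmp (val x d) (val M d)
  ... | tri≈ _ eq _ = contradiction eq neq
  ... | tri> _ _ M<x = let _ , _ , _ , step , _ , z∈ = toward M∈ x∈ (λ k k<d → sym (agree k k<d)) M<x
                       in contradiction z∈ (max step)
  ... | tri< x<M _ _ with toward x∈ M∈ agree x<M
  ≤B-maximal zero h _ _ _ | no _ | _ | tri< _ _ _ | _ , _ , _ , step , _ = contradiction h (step-exhausted step)
  ≤B-maximal (suc k) h x∈ M∈ max | no _ | _ | tri< _ _ _ | _ , _ , _ , step , _ , z∈ =
    step ◅ ≤B-maximal k (step-fuel step h) z∈ M∈ max

  hasMax : HasMax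
  hasMax = let M , M∈ , max = maximal (n * n) (m≤m+n _ (inv identity)) identity∈
           in M , M∈ , λ x x∈ → ≤B-maximal (n * n) (m≤m+n _ (inv x)) x∈ M∈ max

  -- Each cover adds one inversion, so the two ends determine the length of a chain.
  graded : Graded
  graded m M _ _ _ _ zs ws cs cs′ = +-cancelʳ-≡ (inv m) _ _ (trans (chain-length zs cs) (sym (chain-length ws cs′)))

  elShellable : ELShellable
  elShellable = hasMin , hasMax , graded , Label , label , isELLabelling

-- Standard cyclic forms

-- isStart k c p: does a block start at position p, when k entries of the current block remain
-- before the blocks of lengths c? (The lengths are positive: a length 0 would count as 1.)
isStart : ℕ → List ℕ → ℕ → Bool
isStart zero [] p = false
isStart zero (m ∷ c) zero = true
isStart zero (m ∷ c) (suc p) = isStart (pred m) c p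
isStart (suc k) c zero = false
isStart (suc k) c (suc p) = isStart k c p

unique-disjoint : ∀ {A : Set} (xs : List A) {ys b} → Unique (xs ++ ys) → b ∈ xs → b ∈ ys → ∀ {Q : Set} → Q
unique-disjoint (x ∷ xs) (x∉ ∷ _) (here refl) b∈ys = contradiction refl (All.lookup x∉ (∈-++⁺ʳ xs b∈ys))
unique-disjoint (x ∷ xs) (_ ∷ u) (there b∈xs) b∈ys = unique-disjoint xs u b∈xs b∈ys

unique-++ʳ : ∀ {A : Set} (xs : List A) {ys} → Unique (xs ++ ys) → Unique ys
unique-++ʳ [] u = u
unique-++ʳ (x ∷ xs) (_ ∷ u) = unique-++ʳ xs u

source-functional : ∀ {A B : Set} (es : List (A × B)) → Unique (map proj₁ es) →
  ∀ {u v v′} → (u , v) ∈ es → (u , v′) ∈ es → v ≡ v′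
source-functional _ _ (here refl) (here refl) = refl
source-functional (_ ∷ es) (u∉ ∷ _) (here refl) (there q) = contradiction refl (All.lookup u∉ (∈-map⁺ proj₁ q))
source-functional (_ ∷ es) (u∉ ∷ _) (there p) (here refl) = contradiction refl (All.lookup u∉ (∈-map⁺ proj₁ p))
source-functional (_ ∷ es) (_ ∷ u) (there p) (there q) = source-functional es u p q

module _ {n : ℕ} where

  -- The list form of `MinimumAt`; shifting `f` along the list lets `isStart` unfold block by block.
  MinimaAt : (ℕ → Bool) → List (Fin n) → Set
  MinimaAt f [] = ⊤
  MinimaAt f (a ∷ ws) = (T (f 0) → All (a Fin.<_) ws) × MinimaAt (f ∘ suc) ws

  MinimaAt⇒lookup : ∀ f {k} (x : Vec (Fin n) k) → MinimaAt f (toList x) →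
    ∀ p q → T (f (toℕ p)) → p Fin.< q → lookup x p Fin.< lookup x q
  MinimaAt⇒lookup f (a ∷ x) (min , _) zero (suc q) t _ = All.lookup (min t) (Vec.∈-toList⁺ (Vec.∈-lookup q x))
  MinimaAt⇒lookup f (a ∷ x) (_ , mins) (suc p) (suc q) t (s≤s p<q) = MinimaAt⇒lookup (f ∘ suc) x mins p q t p<q

  lookup⇒MinimaAt : ∀ f {k} (x : Vec (Fin n) k) →
    (∀ p q → T (f (toℕ p)) → p Fin.< q → lookup x p Fin.< lookup x q) → MinimaAt f (toList x)
  lookup⇒MinimaAt f [] m = tt
  lookup⇒MinimaAt f (a ∷ x) m =
    (λ t → VAll.toList⁺ (VAll.lookup⁻ λ q → m zero (suc q) t (s≤s z≤n))) ,
    lookup⇒MinimaAt (f ∘ suc) x λ p q t p<q → m (suc p) (suc q) t (s≤s p<q)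

  entries : List (Cycle n) → List (Fin n)
  entries cs = concat (map cycleList cs)

  first-<-entries : ∀ {a} cs → Linked Fin._<_ (a ∷ map proj₁ cs) → All StartsWithMin cs → All (a Fin.<_) (entries cs)
  first-<-entries [] _ _ = []
  first-<-entries ((b , r) ∷ cs) (a<b ∷ l) (b≤r ∷ mins) =
    a<b ∷ All.++⁺ (All.map (<-≤-trans a<b) b≤r) (All.map (Fin.<-trans a<b) (first-<-entries cs l mins))

  block-MinimaAt : ∀ r {c ws} → MinimaAt (isStart 0 c) ws → MinimaAt (isStart (length r) c) (r ++ ws)
  block-MinimaAt [] m = m
  block-MinimaAt (b ∷ r) m = (λ ()) , block-MinimaAt r m

  entries-MinimaAt : ∀ cs → Unique (entries cs) → All StartsWithMin cs → Linked Fin._<_ (map proj₁ cs) →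
    MinimaAt (isStart 0 (compositionType cs)) (entries cs)
  entries-MinimaAt [] _ _ _ = tt
  entries-MinimaAt ((a , r) ∷ cs) (a∉ ∷ u) (a≤r ∷ mins) l =
    (λ _ → All.++⁺ (All.zipWith (λ { (a≤b , a≢b) → Fin.≤∧≢⇒< a≤b a≢b }) (a≤r , All.++⁻ˡ r a∉))
                   (first-<-entries cs l mins)) ,
    block-MinimaAt r (entries-MinimaAt cs (unique-++ʳ r u) mins (Linked.tail l))

  split-block : ∀ k {c} ws → MinimaAt (isStart k c) ws → length ws ≡ k + sum c →
    ∃[ r ] ∃[ vs ] (ws ≡ r ++ vs × length r ≡ k × MinimaAt (isStart 0 c) vs × length vs ≡ sum c)
  split-block zero ws m len = [] , ws , refl , refl , m , len
  split-block (suc k) (b ∷ ws) (_ , m) len with split-block k ws m (suc-injective len)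
  ... | r , vs , refl , lr , m′ , lv = b ∷ r , vs , refl , cong suc lr , m′ , lv

  -- Cut the word into blocks of the given lengths. The entry at a block start is below the rest of
  -- its block, which makes it the least of its cycle, and below the next block start, which orders
  -- the cycles.
  split-cycles : ∀ c ws → All (0 <_) c → length ws ≡ sum c → MinimaAt (isStart 0 c) ws →
    ∃[ cs ] (ws ≡ entries cs × compositionType cs ≡ c × All StartsWithMin cs × Linked Fin._<_ (map proj₁ cs))
  split-cycles [] [] _ _ _ = [] , refl , refl , [] , []
  split-cycles (suc k ∷ c) (a ∷ ws) (_ ∷ pos) len (min , m) with split-block k ws m (suc-injective len)
  ... | r , vs , refl , refl , m′ , lv with split-cycles c vs pos lv m′
  ... | cs , refl , refl , mins , l =
    (a , r) ∷ cs , refl , refl , All.map <⇒≤ (All.++⁻ˡ r (min tt)) ∷ mins , link cs (All.++⁻ʳ r (min tt)) l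
    where
    link : ∀ cs → All (a Fin.<_) (entries cs) → Linked Fin._<_ (map proj₁ cs) → Linked Fin._<_ (a ∷ map proj₁ cs)
    link [] _ _ = [-]
    link (_ ∷ cs) (a<b ∷ _) l = a<b ∷ l

  -- Uniqueness of the standard cyclic form

  orbit-unique : ∀ {π : Word n} {b a} r r′ → a ∉ r → a ∉ r′ →
    Linked (λ u v → lookup π u ≡ v) (b ∷ r ++ [ a ]) → Linked (λ u v → lookup π u ≡ v) (b ∷ r′ ++ [ a ]) → r ≡ r′
  orbit-unique [] [] _ _ _ _ = refl
  orbit-unique [] (c ∷ r′) _ a∉ (eq ∷ _) (eq′ ∷ _) = contradiction (here (trans (sym eq) eq′)) a∉
  orbit-unique (c ∷ r) [] a∉ _ (eq ∷ _) (eq′ ∷ _) = contradiction (here (trans (sym eq′) eq)) a∉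
  orbit-unique {π} (c ∷ r) (c′ ∷ r′) a∉ a∉′ (eq ∷ l) (eq′ ∷ l′) with trans (sym eq) eq′
  ... | refl = cong (c ∷_) (orbit-unique {π} r r′ (a∉ ∘ there) (a∉′ ∘ there) l l′)

  -- A standard cyclic form of part of the ground set, so that removing the first cycle leaves
  -- another one.
  record CyclesOf (π : Word n) (cs : List (Cycle n)) : Set where
    constructor cyclesOf
    field
      unique : Unique (entries cs)
      orbits : All (IsCycleOf π) cs
      minima : All StartsWithMin cs
      ordered : Linked Fin._<_ (map proj₁ cs)

  head-minimum : ∀ {π a r cs} → CyclesOf π ((a , r) ∷ cs) → ∀ {b} → b ∈ entries ((a , r) ∷ cs) → a Fin.≤ b
  head-minimum {cs = cs} (cyclesOf _ _ (a≤r ∷ mins) l) =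
    All.lookup (Fin.≤-refl ∷ All.++⁺ a≤r (All.map <⇒≤ (first-<-entries cs l mins)))

  head-∉ : ∀ {π a r cs} → CyclesOf π ((a , r) ∷ cs) → a ∉ r
  head-∉ {r = r} (cyclesOf (a∉ ∷ _) _ _ _) a∈r = All.lookup a∉ (∈-++⁺ˡ a∈r) refl

  tail-cycles : ∀ {π c cs} → CyclesOf π (c ∷ cs) → CyclesOf π cs
  tail-cycles {c = c} (cyclesOf u (_ ∷ o) (_ ∷ m) l) = cyclesOf (unique-++ʳ (cycleList c) u) o m (Linked.tail l)

  tail-∈ : ∀ {π c cs cs′} → CyclesOf π (c ∷ cs) → (∀ {b} → b ∈ entries (c ∷ cs) → b ∈ entries (c ∷ cs′)) →
    ∀ {b} → b ∈ entries cs → b ∈ entries cs′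
  tail-∈ {c = c} C sub b∈ with ∈-++⁻ (cycleList c) (sub (∈-++⁺ʳ (cycleList c) b∈))
  ... | inj₁ b∈c = unique-disjoint (cycleList c) (CyclesOf.unique C) b∈c b∈
  ... | inj₂ b∈cs′ = b∈cs′

  -- The first entry is the minimum of the common set of entries, and following `π` until it returns
  -- there determines the first cycle. Distinctness of the entries leaves equal sets for the
  -- induction.
  cycles-unique : ∀ {π cs cs′} → CyclesOf π cs → CyclesOf π cs′ →
    (∀ {b} → b ∈ entries cs → b ∈ entries cs′) → (∀ {b} → b ∈ entries cs′ → b ∈ entries cs) → cs ≡ cs′
  cycles-unique {cs = []} {[]} _ _ _ _ = refl
  cycles-unique {cs = []} {_ ∷ _} _ _ _ sup with sup (here refl)
  ... | ()
  cycles-unique {cs = _ ∷ _} {[]} _ _ sub _ with sub (here refl)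
  ... | ()
  cycles-unique {π} {(a , r) ∷ cs} {(a′ , r′) ∷ cs′} C C′ sub sup
    with Fin.≤-antisym (head-minimum C (sup (here refl))) (head-minimum C′ (sub (here refl)))
  ... | refl with orbit-unique {π} r r′ (head-∉ C) (head-∉ C′) (All.head (CyclesOf.orbits C)) (All.head (CyclesOf.orbits C′))
  ... | refl = cong (_ ∷_) (cycles-unique (tail-cycles C) (tail-cycles C′) (tail-∈ {cs′ = cs′} C sub) (tail-∈ {cs′ = cs} C′ sup))

  -- `InC` provides one form for the composition type and one for Ω; this identifies them.
  stdCyclicForm-unique : ∀ {π cs cs′} → IsStdCyclicForm π cs → IsStdCyclicForm π cs′ → cs ≡ cs′
  stdCyclicForm-unique {π} (u , all , o , m , l) (u′ , all′ , o′ , m′ , l′) =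
    cycles-unique {π} (cyclesOf u o m l) (cyclesOf u′ o′ m′ l′) (λ {b} _ → all′ b) (λ {b} _ → all b)

  -- A permutation with given cycles

  links : Fin n → List (Fin n) → Fin n → List (Fin n × Fin n)
  links b [] a = [ b , a ]
  links b (c ∷ r) a = (b , c) ∷ links c r a

  edges : List (Cycle n) → List (Fin n × Fin n)
  edges [] = []
  edges ((a , r) ∷ cs) = links a r a ++ edges cs

  links-sources : ∀ b r a → map proj₁ (links b r a) ≡ b ∷ r
  links-sources b [] a = refl
  links-sources b (c ∷ r) a = cong (b ∷_) (links-sources c r a)

  edges-sources : ∀ cs → map proj₁ (edges cs) ≡ entries cs
  edges-sources [] = refl
  edges-sources ((a , r) ∷ cs) = trans (map-++ proj₁ (links a r a) (edges cs))
    (cong₂ _++_ (links-sources a r a) (edges-sources cs))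

  links-closing : ∀ b r a → ∃[ u ] (u , a) ∈ links b r a
  links-closing b [] a = b , here refl
  links-closing b (c ∷ r) a = let u , u∈ = links-closing c r a in u , there u∈

  links-target : ∀ b r a {v} → v ∈ r → ∃[ u ] (u , v) ∈ links b r a
  links-target b (c ∷ r) a (here refl) = b , here refl
  links-target b (c ∷ r) a (there v∈) = let u , u∈ = links-target c r a v∈ in u , there u∈

  edges-target : ∀ cs {v} → v ∈ entries cs → ∃[ u ] (u , v) ∈ edges cs
  edges-target ((a , r) ∷ cs) v∈ with ∈-++⁻ (a ∷ r) v∈
  ... | inj₁ (here refl) = let u , u∈ = links-closing a r a in u , ∈-++⁺ˡ u∈
  ... | inj₁ (there v∈r) = let u , u∈ = links-target a r a v∈r in u , ∈-++⁺ˡ u∈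
  ... | inj₂ v∈cs = let u , u∈ = edges-target cs v∈cs in u , ∈-++⁺ʳ (links a r a) u∈

  links-linked : ∀ {R : Fin n → Fin n → Set} b r a → (∀ {u v} → (u , v) ∈ links b r a → R u v) →
    Linked R (b ∷ r ++ [ a ])
  links-linked b [] a h = h (here refl) ∷ [-]
  links-linked b (c ∷ r) a h = h (here refl) ∷ links-linked c r a (h ∘ there)

  edges-orbits : ∀ {π} cs → (∀ {u v} → (u , v) ∈ edges cs → lookup π u ≡ v) → All (IsCycleOf π) cs
  edges-orbits [] h = []
  edges-orbits {π} ((a , r) ∷ cs) h =
    links-linked a r a (h ∘ ∈-++⁺ˡ) ∷ edges-orbits {π} cs (h ∘ ∈-++⁺ʳ (links a r a))

  -- A section of `f` is injective, hence surjective by finiteness, so `f` is inverse to it.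
  surjective⇒injective : ∀ (f : Fin n → Fin n) → (∀ v → ∃[ u ] f u ≡ v) → ∀ {i j} → f i ≡ f j → i ≡ j
  surjective⇒injective f surj {i} {j} fi≡fj with section-surjective i | section-surjective j
    where
    section : Fin n → Fin n
    section v = proj₁ (surj v)
    section-surjective : ∀ u → ∃[ v ] section v ≡ u
    section-surjective = injective⇒surjective section λ {v} {v′} eq →
      trans (sym (proj₂ (surj v))) (trans (cong f eq) (proj₂ (surj v′)))
  ... | v , refl | v′ , refl =
    cong (proj₁ ∘ surj) (trans (sym (proj₂ (surj v))) (trans fi≡fj (proj₂ (surj v′))))

  -- Every element is the source of exactly one edge, so the edges form the graph of a function;
  -- every element is also a target, so the function is a bijection.
  permutation-of-cycles : ∀ cs → Unique (entries cs) → (∀ a → a ∈ entries cs) →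
    ∃[ π ] (IsPerm π × All (IsCycleOf π) cs)
  permutation-of-cycles cs u all = π ,
    toList-unique π (λ i j eq → surjective⇒injective (lookup π) π-surjective eq) ,
    edges-orbits {π} cs λ e → source-functional (edges cs) sources-unique (π-edge _) e
    where
    image : ∀ u → ∃[ v ] (u , v) ∈ edges cs
    image u with ∈-map⁻ proj₁ (subst (u ∈_) (sym (edges-sources cs)) (all u))
    ... | (_ , v) , e , refl = v , e
    π : Word n
    π = tabulate (proj₁ ∘ image)
    sources-unique : Unique (map proj₁ (edges cs))
    sources-unique = subst Unique (sym (edges-sources cs)) u
    π-edge : ∀ u → (u , lookup π u) ∈ edges cs
    π-edge u = subst (λ v → (u , v) ∈ edges cs) (sym (lookup∘tabulate (proj₁ ∘ image) u)) (proj₂ (image u))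
    π-surjective : ∀ v → ∃[ u ] lookup π u ≡ v
    π-surjective v = let u , e = edges-target cs (all v) in u , source-functional (edges cs) sources-unique (π-edge u) e

  -- Membership in C_c as minima at the block starts

  InC⇒minima : ∀ {c} {w : Word n} → InC c w → Inj w × MinimumAt (T ∘ isStart 0 c) (val w)
  InC⇒minima {w = w} (π , (_ , cs , std , refl) , cs′ , std′@(u , _ , _ , m , l) , eq) with stdCyclicForm-unique {π} std std′
  ... | refl = perm⇒inj (subst Unique (sym eq) u) ,
    lookup⇒MinimumAt (MinimaAt⇒lookup (isStart 0 (compositionType cs)) w
      (subst (MinimaAt _) (sym eq) (entries-MinimaAt cs u m l)))

  minima⇒InC : ∀ {c} {w : Word n} → IsComposition n c → Inj w → MinimumAt (T ∘ isStart 0 c) (val w) → InC c w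
  minima⇒InC {c} {w} (pos , sum≡n) inj min
    with split-cycles c (toList w) pos (trans (length-toList w) (sym sum≡n))
           (lookup⇒MinimaAt (isStart 0 c) w (MinimumAt⇒lookup min))
  ... | cs , eq , refl , m , l =
    let π , perm , orbits = permutation-of-cycles cs u all
        std = u , all , orbits , m , l
    in π , (perm , cs , std , refl) , cs , std , eq
    where
    u : Unique (entries cs)
    u = subst Unique eq (inj⇒perm inj)
    all : ∀ a → a ∈ entries cs
    all a with injective⇒surjective (lookup w) (toList-lookup-injective w (inj⇒perm {x = w} inj) _ _) a
    ... | i , refl = subst (lookup w i ∈_) eq (Vec.∈-toList⁺ (Vec.∈-lookup i w))

theoremC : (n : ℕ) (c : List ℕ) → IsComposition n c → SubPoset.ELShellable (InC {n} c)
theoremC n c comp = ELProof.elShellable (InC c) (λ p → T? (isStart 0 c p)) InC⇒minima (minima⇒InC comp)
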